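{- For all $x,y\in(0,1]$ and every integer $k\ge 1$, $$\max(x,y)\le \phi(x,y)\le \psi(x,y)\le \xi(x,y)\le \frac{\lceil kx\rceil+\lceil ky\rceil-1}{k}.$$
   Context: All graphs are finite, with no loops or multiple edges. $(0,1]$ is the set of reals $t$ with $0<t\le 1$. A tripartition of a graph $G$ is a partition $(A,B,C)$ of $V(G)$ into three nonempty stable (independent) sets. For $x,y\in(0,1]$, $G$ is $(x,y)$-constrained via a tripartition $(A,B,C)$ if every vertex in $A$ has at least $x|B|$ neighbours in $B$, every vertex in $B$ has at least $y|C|$ neighbours in $C$, and there are no edges between $A$ and $C$. $G$ is $(x,y)$-biconstrained via $(A,B,C)$ if it is $(x,y)$-constrained via $(A,B,C)$ and in addition every vertex in $B$ has at least $x|A|$ neighbours in $A$ and every vertex in $C$ has at least $y|B|$ neighbours in $B$. $G$ is $(x,y)$-exact via $(A,B,C)$ if it is $(x,y)$-constrained via $(A,B,C)$ and in addition there exist $x'\ge x$ and $y'\ge y$ such that every vertex in $A$ has exactly $x'|B|$ neighbours in $B$, every vertex in $B$ has exactly $x'|A|$ neighbours in $A$, every vertex in $B$ has exactly $y'|C|$ neighbours in $C$, and every vertex in $C$ has exactly $y'|B|$ neighbours in $B$. $N^2(v)$ is the set of vertices at distance exactly two from $v$, and $N^2_A(v)=N^2(v)\cap A$. $\phi(x,y)$ (respectively $\psi(x,y)$, $\xi(x,y)$) is the maximum $z\in(0,1]$ (it exists) such that for every graph $G$ that is $(x,y)$-constrained (respectively $(x,y)$-biconstrained, $(x,y)$-exact)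 via some $(A,B,C)$, there is a vertex $v\in C$ with $|N^2_A(v)|\ge z|A|$. -}

module Defs where

open import Data.Fin using (Fin)
open import Data.Fin.Properties using (any?) renaming (_≟_ to _≟ᶠ_)
open import Data.Fin.Subset using (Subset; _∈_; _∩_; Nonempty; ∣_∣)
open import Data.Integer as ℤ using (ℤ; +_)
open import Data.Nat as ℕ using (ℕ; zero; suc)
import Data.Nat.Properties as ℕP
open import Data.Product using (∃; _×_; _,_)
open import Data.Rational using (ℚ; 0ℚ; 1ℚ; _/_; _<_; _+_; _*_; -_)
import Data.Rational as ℚ
import Data.Rational.Properties as ℚP
open import Data.Sum using (_⊎_; inj₁; inj₂; [_,_])
open import Data.Vec using (tabulate)
open import Relation.Binary using (Rel; Decidable; Symmetric; Irreflexive)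
open import Relation.Binary.PropositionalEquality using (_≡_; refl; subst)
open import Relation.Nullary using (¬_; Dec; does; yes; no; contradiction; ¬?; _×-dec_)
open import Level using (0ℓ)

private
  p-1<p : ∀ p → p + (- 1ℚ) < p
  p-1<p p = subst (p + (- 1ℚ) <_) (ℚP.+-identityʳ p)
                  (ℚP.+-monoʳ-< p (ℚ.*<* ℤ.-<+))

-- Real numbers as Dedekind cuts in the textbook form: nonempty proper
-- lower sets of rationals with no largest element.  Below q says that the
-- rational q is strictly smaller than the real.  No locatedness is imposed,
-- so every such lower set counts as a real number.

record ℝ : Set₁ where
  field
    Below    : ℚ → Set
    nonempty : ∃ Below
    proper   : ∃ λ q → ¬ Below q
    lower    : ∀ {p q} → p < q → Below q → Below p
    open′    : ∀ {p} → Below p → ∃ λ q → p < q × Below q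

open ℝ public

infix 4 _≤ℝ_ _<ℝ_ _≈ℝ_

_≤ℝ_ : ℝ → ℝ → Set
x ≤ℝ y = ∀ {q} → Below x q → Below y q

-- x is properly contained in y.
_<ℝ_ : ℝ → ℝ → Set
x <ℝ y = ∃ λ q → Below y q × ¬ Below x q

-- Equality of reals is extensional equality of cuts.
_≈ℝ_ : ℝ → ℝ → Set
x ≈ℝ y = (x ≤ℝ y) × (y ≤ℝ x)

fromℚ : ℚ → ℝ
fromℚ q = record
  { Below    = _< q
  ; nonempty = q + (- 1ℚ) , p-1<p q
  ; proper   = q , ℚP.<-irrefl refl
  ; lower    = ℚP.<-trans
  ; open′    = λ p<q → let (m , p<m , m<q) = ℚP.<-dense p<q in m , p<m , m<q
  }

fromℤ : ℤ → ℝ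
fromℤ m = fromℚ (m / 1)

fromℕ : ℕ → ℝ
fromℕ n = fromℤ (+ n)

0ℝ 1ℝ : ℝ
0ℝ = fromℚ 0ℚ
1ℝ = fromℚ 1ℚ

private
  <⇒≱ : ∀ {p q} → p < q → ¬ (q ℚ.≤ p)
  <⇒≱ p<q q≤p = ℚP.<-irrefl refl (ℚP.<-≤-trans p<q q≤p)

  below-bound : ∀ x {r u} → Below x r → ¬ Below x u → r < u
  below-bound x {r} {u} r∈x u∉x with r ℚ.<? u
  ... | yes r<u = r<u
  ... | no  r≮u = contradiction (u∈x (ℚP.≮⇒≥ r≮u)) u∉x
    where
    u∈x : u ℚ.≤ r → Below x u
    u∈x u≤r = let (s , r<s , s∈x) = open′ x r∈x
              in lower x (ℚP.≤-<-trans u≤r r<s) s∈x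

infixl 6 _⊔ℝ_

_⊔ℝ_ : ℝ → ℝ → ℝ
x ⊔ℝ y = record
  { Below    = λ q → Below x q ⊎ Below y q
  ; nonempty = let (q , q∈x) = nonempty x in q , inj₁ q∈x
  ; proper   = let (u , u∉x) = proper x
                   (v , v∉y) = proper y
               in u ℚ.⊔ v ,
                  [ (λ b → <⇒≱ (below-bound x b u∉x) (ℚP.p≤p⊔q u v))
                  , (λ b → <⇒≱ (below-bound y b v∉y) (ℚP.p≤q⊔p u v)) ]
  ; lower    = λ p<q → [ (λ b → inj₁ (lower x p<q b))
                       , (λ b → inj₂ (lower y p<q b)) ]
  ; open′    = [ (λ b → let (q , p<q , q∈x) = open′ x b in q , p<q , inj₁ q∈x)
               , (λ b → let (q , p<q , q∈y) = open′ y b in q , p<q , inj₂ q∈y) ]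
  }

infixl 7 _·_

-- The product of the natural number n and the real x.  The strict inequality
-- makes the formula correct for n = 0 as well, where it gives {q ∣ q < 0}.
_·_ : ℕ → ℝ → ℝ
n · x = record
  { Below    = λ q → ∃ λ r → Below x r × q < (+ n / 1) * r
  ; nonempty = let (r , r∈x) = nonempty x
               in (+ n / 1) * r + (- 1ℚ) , r , r∈x , p-1<p _
  ; proper   = let (u , u∉x) = proper x
               in (+ n / 1) * u ,
                  λ (r , r∈x , nu<nr) →
                    <⇒≱ nu<nr
                      (ℚP.*-monoˡ-≤-nonNeg (+ n / 1) {{ℚP.normalize-nonNeg n 1}}
                        (ℚP.<⇒≤ (below-bound x r∈x u∉x)))
  ; lower    = λ p<q (r , r∈x , q<nr) → r , r∈x , ℚP.<-trans p<q q<nr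
  ; open′    = λ (r , r∈x , p<nr) →
                 let (q , p<q , q<nr) = ℚP.<-dense p<nr in q , p<q , r , r∈x , q<nr
  }

IsCeiling : ℝ → ℤ → Set
IsCeiling r m = (r ≤ℝ fromℤ m) × (∀ n → r ≤ℝ fromℤ n → m ℤ.≤ n)

InUnitInterval : ℝ → Set
InUnitInterval t = (0ℝ <ℝ t) × (t ≤ℝ 1ℝ)

record Graph : Set₁ where
  field
    order  : ℕ
    Adj    : Rel (Fin order) 0ℓ
    adj?   : Decidable Adj
    sym    : Symmetric Adj
    irrefl : Irreflexive _≡_ Adj

  V : Set
  V = Fin order

  Walk : ℕ → V → V → Set
  Walk zero    u v = u ≡ v
  Walk (suc l) u v = ∃ λ w → Adj u w × Walk l w v

  walk? : ∀ l u v → Dec (Walk l u v)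
  walk? zero    u v = u ≟ᶠ v
  walk? (suc l) u v = any? λ w → adj? u w ×-dec walk? l w v

  AtDistance : ℕ → V → V → Set
  AtDistance d u v = Walk d u v × (∀ {l} → l ℕ.< d → ¬ Walk l u v)

  atDistance? : ∀ d u v → Dec (AtDistance d u v)
  atDistance? d u v =
    walk? d u v ×-dec ℕP.allUpTo? (λ l → ¬? (walk? l u v)) d

  N : V → Subset order
  N v = tabulate λ u → does (adj? v u)

  N² : V → Subset order
  N² v = tabulate λ u → does (atDistance? 2 v u)

  Stable : Subset order → Set
  Stable S = ∀ {u v} → u ∈ S → v ∈ S → ¬ Adj u v

  Disjoint : Subset order → Subset order → Set
  Disjoint S T = ∀ {v} → v ∈ S → ¬ (v ∈ T)

  AtLeast : ℝ → Subset order → Subset order → Set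
  AtLeast r S T = ∀ {v} → v ∈ S → ∣ T ∣ · r ≤ℝ fromℕ ∣ N v ∩ T ∣

  Exactly : ℝ → Subset order → Subset order → Set
  Exactly r S T = ∀ {v} → v ∈ S → fromℕ ∣ N v ∩ T ∣ ≈ℝ ∣ T ∣ · r

record Tripartition (G : Graph) : Set where
  open Graph G
  field
    A B C      : Subset order
    cover      : ∀ v → v ∈ A ⊎ v ∈ B ⊎ v ∈ C
    disjointAB : Disjoint A B
    disjointAC : Disjoint A C
    disjointBC : Disjoint B C
    nonemptyA  : Nonempty A
    nonemptyB  : Nonempty B
    nonemptyC  : Nonempty C
    stableA    : Stable A
    stableB    : Stable B
    stableC    : Stable C

module _ (x y : ℝ) (G : Graph) (P : Tripartition G) where
  open Graph G
  open Tripartition P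

  record Constrained : Set where
    field
      A→B   : AtLeast x A B
      B→C   : AtLeast y B C
      A-C   : ∀ {u v} → u ∈ A → v ∈ C → ¬ Adj u v

  record Biconstrained : Set where
    field
      constrained : Constrained
      B→A         : AtLeast x B A
      C→B         : AtLeast y C B

  record Exact : Set₁ where
    field
      constrained : Constrained
      x′ y′       : ℝ
      x≤x′        : x ≤ℝ x′
      y≤y′        : y ≤ℝ y′
      A→B         : Exactly x′ A B
      B→A         : Exactly x′ B A
      B→C         : Exactly y′ B C
      C→B         : Exactly y′ C B

HasVertex : ℝ → (G : Graph) → Tripartition G → Set
HasVertex z G P = ∃ λ v → v ∈ C × ∣ A ∣ · z ≤ℝ fromℕ ∣ N² v ∩ A ∣
  where open Graph G
        open Tripartition P

IsMaximumInUnitInterval : (ℝ → Set₁) → ℝ → Set₁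
IsMaximumInUnitInterval Q z =
  InUnitInterval z × Q z × (∀ w → InUnitInterval w → Q w → w ≤ℝ z)

-- φ, ψ and ξ are given as relations: Isφ x y z says that z is the value
-- φ(x,y), which is unique up to _≈ℝ_.

Isφ Isψ Isξ : ℝ → ℝ → ℝ → Set₁
Isφ x y = IsMaximumInUnitInterval λ z → ∀ G P → Constrained   x y G P → HasVertex z G P
Isψ x y = IsMaximumInUnitInterval λ z → ∀ G P → Biconstrained x y G P → HasVertex z G P
Isξ x y = IsMaximumInUnitInterval λ z → ∀ G P → Exact         x y G P → HasVertex z G P

{-# OPTIONS --safe #-}
module Submission where

-- Let v ∈ C maximise m = |N²_A(v)|.  Every b ∈ B has a neighbour in C, so at most m neighbours in A,
-- and counting the A–B edges gives x|A| ≤ m.  Every a ∈ A has a neighbour in B, so at least y|C|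
-- vertices of C at distance two, and counting the pairs at distance two gives y|A| ≤ m.
--
-- For the upper bound put p = ⌈kx⌉, q = ⌈ky⌉, let A, B, C be copies of ℤ/k and join aᵢ to bⱼ when
-- (i + j) mod k < p and bⱼ to cₗ when (j + l) mod k < q.  This graph is exact with x′ = p/k and
-- y′ = q/k, and if aᵢ and cₗ have a common neighbour then i − l is congruent to one of the p + q − 1
-- integers strictly between −q and p.

open import Defs
open import Data.Integer using (ℤ; _+_; _-_; 1ℤ)
open import Data.Nat using (ℕ; NonZero)
open import Data.Product using (_×_)
open import Data.Rational using (_/_)

open import Data.Bool using (Bool; true; false; if_then_else_; _∧_)
open import Data.Empty using (⊥)
open import Data.Fin using (Fin; zero; suc; toℕ; splitAt)
open import Data.Fin.Patterns using (0F; 1F; 2F)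
open import Data.Fin.Permutation using (Permutation′; permutation)
open import Data.Fin.Properties using (toℕ-fromℕ<; toℕ-injective; toℕ<n) renaming (_≟_ to _≟ᶠ_)
open import Data.Fin.Subset using (Subset; _∈_; _∩_; ∣_∣; Nonempty)
open import Data.Fin.Subset.Properties using (_∈?_; p⊆q⇒∣p∣≤∣q∣; x∈p∩q⁺; x∈p∩q⁻)
open import Data.Integer as ℤ using (+_)
import Data.Integer.Properties as ℤP
open import Data.List using (filter; allFin)
import Data.List.Relation.Unary.All as All
open import Data.List.Membership.Propositional.Properties using (∈-filter⁺; ∈-allFin)
open import Data.List.Relation.Unary.All.Properties using (all-filter)
open import Data.Nat as ℕ using (suc; zero; _%_)
open import Data.Nat.Divisibility using (n∣m*n)
open import Data.Nat.DivMod using (_mod_; %-distribˡ-+; %-remove-+ʳ; m%n%n≡m%n; m%n≤m; m<n⇒m%n≡m; [m+n]%n≡m%n)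
import Data.Nat.Properties as ℕP
open import Data.Nat.Solver using (module +-*-Solver)
open import Data.Product using (_,_; ∃; proj₁; proj₂)
open import Data.Rational as ℚ using (0ℚ)
import Data.Rational.Properties as ℚP
open import Data.Rational.Unnormalised as ℚᵘ using (mkℚᵘ; *≡*; *≤*)
import Data.Rational.Unnormalised.Properties as ℚᵘP
open import Data.Sum using (_⊎_; inj₁; inj₂; [_,_]; map₁)
open import Data.Vec using ([]; _∷_; here; there; lookup; tabulate)
open import Data.Vec.Properties using (lookup-zipWith; lookup∘tabulate; []=⇒lookup; lookup⇒[]=)
open import Function using (_∘_)
open import Level using (0ℓ)
open import Relation.Binary using (Rel; Decidable)
open import Relation.Binary.PropositionalEquality
  using (_≡_; _≢_; refl; sym; trans; cong; cong₂; subst; subst₂; module ≡-Reasoning)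
open import Relation.Nullary using (¬_; Dec; does; yes; no; contradiction)

import Data.List.Extrema ℕP.≤-totalOrder as Extrema
open import Algebra.Properties.Semiring.Sum ℕP.+-*-semiring
  using (sum; sum-cong-≗; *-distribˡ-sum; *-distribʳ-sum; ∑-comm; sum-permute; sum-replicate-zero)

-- Multiples of cuts

toℚᵘ-/ : ∀ i n → ℚ.toℚᵘ (i / suc n) ℚᵘ.≃ mkℚᵘ i n
toℚᵘ-/ i n = ℚP.toℚᵘ-fromℚᵘ (mkℚᵘ i n)

/1-mono-≤ : ∀ {i j} → i ℤ.≤ j → i / 1 ℚ.≤ j / 1
/1-mono-≤ {i} {j} i≤j = ℚP.toℚᵘ-cancel-≤ (begin
  ℚ.toℚᵘ (i / 1) ≃⟨ toℚᵘ-/ i 0 ⟩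
  mkℚᵘ i 0       ≤⟨ *≤* (ℤP.*-monoʳ-≤-nonNeg (+ 1) i≤j) ⟩
  mkℚᵘ j 0       ≃⟨ toℚᵘ-/ j 0 ⟨
  ℚ.toℚᵘ (j / 1) ∎)
  where open ℚᵘP.≤-Reasoning

/1-cancel-< : ∀ {i j} → i / 1 ℚ.< j / 1 → i ℤ.< j
/1-cancel-< i<j = ℤP.≰⇒> λ j≤i → ℚP.<-irrefl refl (ℚP.<-≤-trans i<j (/1-mono-≤ j≤i))

n*[i/n]≡i/1 : ∀ n .{{_ : NonZero n}} i → (+ n / 1) ℚ.* (i / n) ≡ i / 1
n*[i/n]≡i/1 (suc n) i = ℚP.toℚᵘ-injective (begin
  ℚ.toℚᵘ ((+ suc n / 1) ℚ.* (i / suc n))          ≈⟨ ℚP.toℚᵘ-homo-* (+ suc n / 1) (i / suc n) ⟩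
  ℚ.toℚᵘ (+ suc n / 1) ℚᵘ.* ℚ.toℚᵘ (i / suc n)    ≈⟨ ℚᵘP.*-cong (toℚᵘ-/ (+ suc n) 0) (toℚᵘ-/ i n) ⟩
  mkℚᵘ (+ suc n) 0 ℚᵘ.* mkℚᵘ i n                  ≈⟨ *≡* cross ⟩
  mkℚᵘ i 0                                        ≈⟨ toℚᵘ-/ i 0 ⟨
  ℚ.toℚᵘ (i / 1)                                  ∎)
  where
  open import Relation.Binary.Reasoning.Setoid ℚᵘP.≃-setoid
  cross : (+ suc n ℤ.* i) ℤ.* + 1 ≡ i ℤ.* + (1 ℕ.* suc n)
  cross = trans (ℤP.*-identityʳ _)
         (trans (ℤP.*-comm (+ suc n) i) (cong (λ m → i ℤ.* + m) (sym (ℕP.*-identityˡ (suc n)))))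

/1-homo-* : ∀ m n → + (m ℕ.* n) / 1 ≡ (+ m / 1) ℚ.* (+ n / 1)
/1-homo-* m n = sym (ℚP.toℚᵘ-injective (begin
  ℚ.toℚᵘ ((+ m / 1) ℚ.* (+ n / 1))          ≈⟨ ℚP.toℚᵘ-homo-* (+ m / 1) (+ n / 1) ⟩
  ℚ.toℚᵘ (+ m / 1) ℚᵘ.* ℚ.toℚᵘ (+ n / 1)    ≈⟨ ℚᵘP.*-cong (toℚᵘ-/ (+ m) 0) (toℚᵘ-/ (+ n) 0) ⟩
  mkℚᵘ (+ m) 0 ℚᵘ.* mkℚᵘ (+ n) 0            ≈⟨ *≡* (cong (ℤ._* + 1) (sym (ℤP.pos-* m n))) ⟩
  mkℚᵘ (+ (m ℕ.* n)) 0                      ≈⟨ toℚᵘ-/ (+ (m ℕ.* n)) 0 ⟨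
  ℚ.toℚᵘ (+ (m ℕ.* n) / 1)                  ∎))
  where open import Relation.Binary.Reasoning.Setoid ℚᵘP.≃-setoid

n/1-nonNeg : ∀ n → ℚ.NonNegative (+ n / 1)
n/1-nonNeg n = ℚP.normalize-nonNeg n 1

n/1-pos : ∀ n .{{_ : NonZero n}} → ℚ.Positive (+ n / 1)
n/1-pos n = ℚP.normalize-pos n 1

-- If `s` were strictly smaller than `n * r`, then `r` would witness that `s` lies in the cut
-- `n · x`, and the hypothesis would give `s < s`.
·-≤⁻ : ∀ {n x s r} → n · x ≤ℝ fromℚ s → Below x r → (+ n / 1) ℚ.* r ℚ.≤ s
·-≤⁻ nx≤s r∈x = ℚP.≮⇒≥ λ s<nr → ℚP.<-irrefl refl (nx≤s (_ , r∈x , s<nr))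

·-≤⁺ : ∀ {n x s} → (∀ {r} → Below x r → (+ n / 1) ℚ.* r ℚ.≤ s) → n · x ≤ℝ fromℚ s
·-≤⁺ nr≤s (r , r∈x , q<nr) = ℚP.<-≤-trans q<nr (nr≤s r∈x)

·-monoʳ-≤ : ∀ n {x y} → x ≤ℝ y → n · x ≤ℝ n · y
·-monoʳ-≤ n x≤y (r , r∈x , q<nr) = r , x≤y r∈x , q<nr

-- Dividing by `n` yields only a weak inequality between rationals. Openness of `x` first replaces
-- `q` by a larger `r` in the cut, so the bound on `q` is strict.
n·x≤i⇒x≤i/n : ∀ n .{{_ : NonZero n}} {x} i → n · x ≤ℝ fromℤ i → x ≤ℝ fromℚ (i / n)
n·x≤i⇒x≤i/n n {x} i nx≤i {q} q∈x with r , q<r , r∈x ← open′ x q∈x =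
  ℚP.<-≤-trans q<r (ℚP.*-cancelˡ-≤-pos (+ n / 1) {{n/1-pos n}}
    (subst (_ ℚ.≤_) (sym (n*[i/n]≡i/1 n i)) (·-≤⁻ {n} {x} nx≤i r∈x)))

n·[i/n]≈i : ∀ n .{{_ : NonZero n}} i → fromℤ i ≈ℝ n · fromℚ (i / n)
n·[i/n]≈i n i = ≤n·[i/n] , ·-≤⁺ {n} {fromℚ (i / n)} n·[i/n]≤
  where
  instance n>0 = n/1-pos n
           n≥0 = n/1-nonNeg n
  ≤n·[i/n] : fromℤ i ≤ℝ n · fromℚ (i / n)
  -- The element of the cut `i / n` must lie strictly below `i / n` and still have `n` times itself
  -- above `q`. Density supplies `m` strictly between `q` and `i`, and `m / n` does both.
  ≤n·[i/n] {q} q<i with m , q<m , m<i ← ℚP.<-dense q<i =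
    ((+ 1 / n) ℚ.* m) ,
    ℚP.*-cancelˡ-<-nonNeg (+ n / 1) (subst₂ ℚ._<_ (sym nm) (sym (n*[i/n]≡i/1 n i)) m<i) ,
    subst (q ℚ.<_) (sym nm) q<m
    where
    nm : (+ n / 1) ℚ.* ((+ 1 / n) ℚ.* m) ≡ m
    nm = trans (sym (ℚP.*-assoc (+ n / 1) (+ 1 / n) m))
        (trans (cong (ℚ._* m) (n*[i/n]≡i/1 n (+ 1))) (ℚP.*-identityˡ m))
  n·[i/n]≤ : ∀ {r} → r ℚ.< i / n → (+ n / 1) ℚ.* r ℚ.≤ i / 1
  n·[i/n]≤ r<i/n = subst (_ ℚ.≤_) (n*[i/n]≡i/1 n i) (ℚP.*-monoˡ-≤-nonNeg (+ n / 1) (ℚP.<⇒≤ r<i/n))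

-- `0ℝ <ℝ x` only provides a nonnegative rational in the cut, possibly zero; openness moves it
-- strictly above zero.
Below-positive : ∀ {x} → 0ℝ <ℝ x → ∃ λ r → 0ℚ ℚ.< r × Below x r
Below-positive {x} (q , q∈x , q≮0) with r , q<r , r∈x ← open′ x q∈x =
  r , ℚP.≤-<-trans (ℚP.≮⇒≥ q≮0) q<r , r∈x

0<n*r : ∀ n .{{_ : NonZero n}} {r} → 0ℚ ℚ.< r → 0ℚ ℚ.< (+ n / 1) ℚ.* r
0<n*r n {r} 0<r = subst (ℚ._< (+ n / 1) ℚ.* r) (ℚP.*-zeroʳ (+ n / 1)) (ℚP.*-monoʳ-<-pos (+ n / 1) {{n/1-pos n}} 0<r)

-- A positive `r` below `x` puts the rational 0 into the cut `n · x`, hence strictly below `m`. This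
-- makes degrees and ceilings positive.
n·x≤m⇒0<m : ∀ n .{{_ : NonZero n}} {x m} → 0ℝ <ℝ x → n · x ≤ℝ fromℤ m → + 0 ℤ.< m
n·x≤m⇒0<m n {x} 0<x nx≤m with r , 0<r , r∈x ← Below-positive {x} 0<x =
  /1-cancel-< (nx≤m (r , r∈x , 0<n*r n 0<r))

n·x≤n : ∀ n {x} → x ≤ℝ 1ℝ → n · x ≤ℝ fromℕ n
n·x≤n n {x} x≤1 = ·-≤⁺ {n} {x} λ {r} r∈x → subst ((+ n / 1) ℚ.* r ℚ.≤_) (ℚP.*-identityʳ (+ n / 1))
  (ℚP.*-monoˡ-≤-nonNeg (+ n / 1) {{n/1-nonNeg n}} (ℚP.<⇒≤ (x≤1 r∈x)))

-- Reads the double count s d ≤ t m with d ≥ t r as s r ≤ m.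
average-≤ : ∀ s t .{{_ : NonZero t}} {r d m} →
  (+ t / 1) ℚ.* r ℚ.≤ + d / 1 → s ℕ.* d ℕ.≤ t ℕ.* m → (+ s / 1) ℚ.* r ℚ.≤ + m / 1
average-≤ s t {r} {d} {m} tr≤d sd≤tm = ℚP.*-cancelˡ-≤-pos T {{n/1-pos t}} (begin
  T ℚ.* (S ℚ.* r)        ≡⟨ ℚP.*-assoc T S r ⟨
  (T ℚ.* S) ℚ.* r        ≡⟨ cong (ℚ._* r) (ℚP.*-comm T S) ⟩
  (S ℚ.* T) ℚ.* r        ≡⟨ ℚP.*-assoc S T r ⟩
  S ℚ.* (T ℚ.* r)        ≤⟨ ℚP.*-monoˡ-≤-nonNeg S {{n/1-nonNeg s}} tr≤d ⟩
  S ℚ.* (+ d / 1)        ≡⟨ /1-homo-* s d ⟨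
  + (s ℕ.* d) / 1        ≤⟨ /1-mono-≤ (ℤ.+≤+ sd≤tm) ⟩
  + (t ℕ.* m) / 1        ≡⟨ /1-homo-* t m ⟩
  T ℚ.* (+ m / 1)        ∎)
  where
  open ℚP.≤-Reasoning
  S = + s / 1
  T = + t / 1

-- Double counting with subsets of Fin n

module _ {n} {P : Fin n → Set} (P? : ∀ i → Dec (P i)) where

  ∈-tabulate⁺ : ∀ {i} → P i → i ∈ tabulate (does ∘ P?)
  ∈-tabulate⁺ {i} p = lookup⇒[]= i _ (trans (lookup∘tabulate (does ∘ P?) i) (does-true (P? i)))
    where
    does-true : (d : Dec (P i)) → does d ≡ true
    does-true (yes _) = refl
    does-true (no ¬p) = contradiction p ¬p

  ∈-tabulate⁻ : ∀ {i} → i ∈ tabulate (does ∘ P?) → P i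
  ∈-tabulate⁻ {i} i∈ = true-does (P? i) (trans (sym (lookup∘tabulate (does ∘ P?) i)) ([]=⇒lookup i∈))
    where
    true-does : (d : Dec (P i)) → does d ≡ true → P i
    true-does (yes p) _ = p

⟦_⟧ : Bool → ℕ
⟦ b ⟧ = if b then 1 else 0

⟦⟧-∧ : ∀ a b → ⟦ a ∧ b ⟧ ≡ ⟦ a ⟧ ℕ.* ⟦ b ⟧
⟦⟧-∧ false b = refl
⟦⟧-∧ true  b = sym (ℕP.+-identityʳ ⟦ b ⟧)

∣p∣≡∑ : ∀ {n} (p : Subset n) → ∣ p ∣ ≡ sum (λ i → ⟦ lookup p i ⟧)
∣p∣≡∑ []          = refl
∣p∣≡∑ (false ∷ p) = ∣p∣≡∑ p
∣p∣≡∑ (true  ∷ p) = cong suc (∣p∣≡∑ p)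

∣p∩q∣≡∑ : ∀ {n} (p q : Subset n) → ∣ p ∩ q ∣ ≡ sum (λ i → ⟦ lookup p i ⟧ ℕ.* ⟦ lookup q i ⟧)
∣p∩q∣≡∑ p q = trans (∣p∣≡∑ (p ∩ q))
  (sum-cong-≗ λ i → trans (cong ⟦_⟧ (lookup-zipWith _∧_ i p q)) (⟦⟧-∧ (lookup p i) (lookup q i)))

sum-mono : ∀ {n} {f g : Fin n → ℕ} → (∀ i → f i ℕ.≤ g i) → sum f ℕ.≤ sum g
sum-mono {zero}  f≤g = ℕ.z≤n
sum-mono {suc n} f≤g = ℕP.+-mono-≤ (f≤g zero) (sum-mono (f≤g ∘ suc))

∣p∣*c≡∑ : ∀ {n} (p : Subset n) c → ∣ p ∣ ℕ.* c ≡ sum (λ i → ⟦ lookup p i ⟧ ℕ.* c)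
∣p∣*c≡∑ {n} p c = trans (cong (ℕ._* c) (∣p∣≡∑ p)) (*-distribʳ-sum {n} c (λ i → ⟦ lookup p i ⟧))

-- The inequality is required only on `p`, because the indicator annihilates both sides elsewhere.
⟦lookup⟧*-mono : ∀ {n} (p : Subset n) i {a b} → (i ∈ p → a ℕ.≤ b) →
  ⟦ lookup p i ⟧ ℕ.* a ℕ.≤ ⟦ lookup p i ⟧ ℕ.* b
⟦lookup⟧*-mono p i a≤b with lookup p i in eq
... | true  = ℕP.*-monoʳ-≤ 1 (a≤b (lookup⇒[]= i p eq))
... | false = ℕ.z≤n

module _ {n} {R : Rel (Fin n) 0ℓ} (R? : Decidable R) where

  row col : Fin n → Subset n
  row u = tabulate λ v → does (R? u v)
  col v = tabulate λ u → does (R? u v)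

  -- Both sides count the related pairs in `S × T`. Expanding the cardinalities into indicator sums
  -- leaves an exchange of the order of summation.
  ∑-row≡∑-col : ∀ S T → sum (λ u → ⟦ lookup S u ⟧ ℕ.* ∣ row u ∩ T ∣)
                      ≡ sum (λ v → ⟦ lookup T v ⟧ ℕ.* ∣ col v ∩ S ∣)
  ∑-row≡∑-col S T = begin
    sum (λ u → s u ℕ.* ∣ row u ∩ T ∣)                     ≡⟨ sum-cong-≗ expand-row ⟩
    sum (λ u → sum λ v → s u ℕ.* (r u v ℕ.* t v))         ≡⟨ ∑-comm {n} {n} (λ u v → s u ℕ.* (r u v ℕ.* t v)) ⟩
    sum (λ v → sum λ u → s u ℕ.* (r u v ℕ.* t v))         ≡⟨ sum-cong-≗ expand-col ⟨
    sum (λ v → t v ℕ.* ∣ col v ∩ S ∣)                     ∎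
    where
    open ≡-Reasoning
    s t : Fin n → ℕ
    s u = ⟦ lookup S u ⟧
    t v = ⟦ lookup T v ⟧
    r : Fin n → Fin n → ℕ
    r u v = ⟦ does (R? u v) ⟧
    expand-row : ∀ u → s u ℕ.* ∣ row u ∩ T ∣ ≡ sum λ v → s u ℕ.* (r u v ℕ.* t v)
    expand-row u = begin
      s u ℕ.* ∣ row u ∩ T ∣                              ≡⟨ cong (s u ℕ.*_) (∣p∩q∣≡∑ (row u) T) ⟩
      s u ℕ.* sum (λ v → ⟦ lookup (row u) v ⟧ ℕ.* t v)   ≡⟨ *-distribˡ-sum {n} (s u) (λ v → ⟦ lookup (row u) v ⟧ ℕ.* t v) ⟩
      sum (λ v → s u ℕ.* (⟦ lookup (row u) v ⟧ ℕ.* t v))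
        ≡⟨ sum-cong-≗ (λ v → cong (λ b → s u ℕ.* (⟦ b ⟧ ℕ.* t v)) (lookup∘tabulate _ v)) ⟩
      sum (λ v → s u ℕ.* (r u v ℕ.* t v))                ∎
    expand-col : ∀ v → t v ℕ.* ∣ col v ∩ S ∣ ≡ sum λ u → s u ℕ.* (r u v ℕ.* t v)
    expand-col v = begin
      t v ℕ.* ∣ col v ∩ S ∣                              ≡⟨ cong (t v ℕ.*_) (∣p∩q∣≡∑ (col v) S) ⟩
      t v ℕ.* sum (λ u → ⟦ lookup (col v) u ⟧ ℕ.* s u)   ≡⟨ *-distribˡ-sum {n} (t v) (λ u → ⟦ lookup (col v) u ⟧ ℕ.* s u) ⟩
      sum (λ u → t v ℕ.* (⟦ lookup (col v) u ⟧ ℕ.* s u))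
        ≡⟨ sum-cong-≗ (λ u → trans (cong (λ b → t v ℕ.* (⟦ b ⟧ ℕ.* s u)) (lookup∘tabulate _ u))
                                   (reorder (t v) (r u v) (s u))) ⟩
      sum (λ u → s u ℕ.* (r u v ℕ.* t v))                ∎
      where
      reorder : ∀ a b c → a ℕ.* (b ℕ.* c) ≡ c ℕ.* (b ℕ.* a)
      reorder a b c = trans (ℕP.*-comm a (b ℕ.* c)) (trans (cong (ℕ._* a) (ℕP.*-comm b c)) (ℕP.*-assoc c b a))

  double-count : ∀ {S T d m} → (∀ {u} → u ∈ S → d ℕ.≤ ∣ row u ∩ T ∣) →
                 (∀ {v} → v ∈ T → ∣ col v ∩ S ∣ ℕ.≤ m) → ∣ S ∣ ℕ.* d ℕ.≤ ∣ T ∣ ℕ.* m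
  double-count {S} {T} {d} {m} d≤row col≤m = begin
    ∣ S ∣ ℕ.* d                                     ≡⟨ ∣p∣*c≡∑ S d ⟩
    sum (λ u → ⟦ lookup S u ⟧ ℕ.* d)                ≤⟨ sum-mono (λ u → ⟦lookup⟧*-mono S u d≤row) ⟩
    sum (λ u → ⟦ lookup S u ⟧ ℕ.* ∣ row u ∩ T ∣)    ≡⟨ ∑-row≡∑-col S T ⟩
    sum (λ v → ⟦ lookup T v ⟧ ℕ.* ∣ col v ∩ S ∣)    ≤⟨ sum-mono (λ v → ⟦lookup⟧*-mono T v col≤m) ⟩
    sum (λ v → ⟦ lookup T v ⟧ ℕ.* m)                ≡⟨ ∣p∣*c≡∑ T m ⟨
    ∣ T ∣ ℕ.* m                                     ∎
    where open ℕP.≤-Reasoning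

module _ {n} (f : Fin n → ℕ) {S : Subset n} (S≢∅ : Nonempty S) where

  private
    elements = filter (_∈? S) (allFin n)

  minimiser : ∃ λ u → u ∈ S × (∀ {v} → v ∈ S → f u ℕ.≤ f v)
  -- The given member of `S` is the starting value of `argmin`, so the result lies in `S`.
  minimiser = Extrema.argmin f (proj₁ S≢∅) elements
    , Extrema.argmin-all f (proj₂ S≢∅) (all-filter (_∈? S) (allFin n))
    , λ v∈S → All.lookup (Extrema.f[argmin]≤f[xs] {f = f} (proj₁ S≢∅) elements) (∈-filter⁺ (_∈? S) (∈-allFin _) v∈S)

  maximiser : ∃ λ u → u ∈ S × (∀ {v} → v ∈ S → f v ℕ.≤ f u)
  maximiser = Extrema.argmax f (proj₁ S≢∅) elements
    , Extrema.argmax-all f (proj₂ S≢∅) (all-filter (_∈? S) (allFin n))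
    , λ v∈S → All.lookup (Extrema.f[xs]≤f[argmax] {f = f} (proj₁ S≢∅) elements) (∈-filter⁺ (_∈? S) (∈-allFin _) v∈S)

nonempty⇒∣∣≢0 : ∀ {n} {S : Subset n} → Nonempty S → NonZero ∣ S ∣
nonempty⇒∣∣≢0 {S = S} (u , u∈S) = ℕ.>-nonZero (x∈p⇒0<∣p∣ u∈S)
  where
  x∈p⇒0<∣p∣ : ∀ {n} {p : Subset n} {x} → x ∈ p → 0 ℕ.< ∣ p ∣
  x∈p⇒0<∣p∣ {p = true ∷ p}  _            = ℕ.z<s
  x∈p⇒0<∣p∣ {p = false ∷ p} (there x∈p) = x∈p⇒0<∣p∣ x∈p

0<∣p∣⇒nonempty : ∀ {n} (p : Subset n) → 0 ℕ.< ∣ p ∣ → Nonempty p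
0<∣p∣⇒nonempty (true  ∷ p) _   = zero , here
0<∣p∣⇒nonempty (false ∷ p) 0<p with i , i∈p ← 0<∣p∣⇒nonempty p 0<p = suc i , there i∈p

-- The lower bound on the rows is rational, while `double-count` takes a natural number. The
-- smallest row size over `S` is a natural number that bounds every row and itself satisfies the
-- rational bound.
average : ∀ {n} {R : Rel (Fin n) 0ℓ} (R? : Decidable R) {S T : Subset n} → Nonempty S → Nonempty T → ∀ {r m} →
  (∀ {u} → u ∈ S → (+ ∣ T ∣ / 1) ℚ.* r ℚ.≤ + ∣ row R? u ∩ T ∣ / 1) →
  (∀ {v} → v ∈ T → ∣ col R? v ∩ S ∣ ℕ.≤ m) →
  (+ ∣ S ∣ / 1) ℚ.* r ℚ.≤ + m / 1
average R? {S} {T} S≢∅ T≢∅ {r} {m} Tr≤row col≤m with u , u∈S , min ← minimiser (λ u → ∣ row R? u ∩ T ∣) S≢∅ =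
  average-≤ ∣ S ∣ ∣ T ∣ {{nonempty⇒∣∣≢0 T≢∅}} {r} {∣ row R? u ∩ T ∣} {m} (Tr≤row u∈S) (double-count R? {S} {T} min col≤m)

∩-monoˡ-∣∣ : ∀ {n} {p q s : Subset n} → (∀ {i} → i ∈ p → i ∈ s → i ∈ q) → ∣ p ∩ s ∣ ℕ.≤ ∣ q ∩ s ∣
∩-monoˡ-∣∣ {p = p} {q} {s} p⊆q = p⊆q⇒∣p∣≤∣q∣ λ i∈p∩s →
  let (i∈p , i∈s) = x∈p∩q⁻ p s i∈p∩s in x∈p∩q⁺ (p⊆q i∈p i∈s , i∈s)

-- The lower bound max(x, y)

module _ (G : Graph) (P : Tripartition G) where
  open Graph G
  open Tripartition P

  AtLeast⇒neighbour : ∀ {z S T} → 0ℝ <ℝ z → Nonempty T → AtLeast z S T →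
                      ∀ {v} → v ∈ S → ∃ λ u → u ∈ T × Adj v u
  AtLeast⇒neighbour {z} {S} {T} 0<z T≢∅ z≤deg {v} v∈S
    with u , u∈N∩T ← 0<∣p∣⇒nonempty (N v ∩ T)
           (ℤP.drop‿+<+ (n·x≤m⇒0<m ∣ T ∣ {{nonempty⇒∣∣≢0 T≢∅}} {z} 0<z (z≤deg v∈S)))
    with u∈N , u∈T ← x∈p∩q⁻ (N v) T u∈N∩T = u , u∈T , ∈-tabulate⁻ (adj? v) u∈N

  module _ {x y : ℝ} (0<x : 0ℝ <ℝ x) (0<y : 0ℝ <ℝ y) (con : Constrained x y G P) where
    open Constrained con

    -- The path through `b` has length two. Length zero is excluded by disjointness of `A` and `C`,
    -- length one by the absence of edges between them.
    atDistance2 : ∀ {a b c} → a ∈ A → c ∈ C → Adj c b → Adj b a → AtDistance 2 c a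
    atDistance2 {a} {b} {c} a∈A c∈C cb ba = (b , cb , a , ba , refl) , noShorter
      where
      noShorter : ∀ {l} → l ℕ.< 2 → ¬ Walk l c a
      noShorter {0} _ refl             = disjointAC a∈A c∈C
      noShorter {1} _ (_ , ca , refl)  = A-C a∈A c∈C (Graph.sym G ca)
      noShorter {suc (suc _)} (ℕ.s≤s (ℕ.s≤s ()))

    ∣N∩A∣≤∣N²∩A∣ : ∀ {b c} → c ∈ C → Adj b c → ∣ col adj? b ∩ A ∣ ℕ.≤ ∣ N² c ∩ A ∣
    ∣N∩A∣≤∣N²∩A∣ {b} {c} c∈C bc = ∩-monoˡ-∣∣ {p = col adj? b} {N² c} {A} λ {a} a∈N a∈A →
      ∈-tabulate⁺ (atDistance? 2 c)
        (atDistance2 a∈A c∈C (Graph.sym G bc) (Graph.sym G (∈-tabulate⁻ (λ u → adj? u b) a∈N)))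

    -- Every neighbour of `b` in `C` is at distance two from `a` through `b`. The relation takes its
    -- arguments in reversed order so that rows belong to `A` and columns to `C`.
    ∣N∩C∣≤∣N²∩C∣ : ∀ {a b} → a ∈ A → Adj a b → ∣ N b ∩ C ∣ ℕ.≤ ∣ row (λ a c → atDistance? 2 c a) a ∩ C ∣
    ∣N∩C∣≤∣N²∩C∣ {a} {b} a∈A ab = ∩-monoˡ-∣∣ {p = N b} {row (λ a c → atDistance? 2 c a) a} {C} λ {c} c∈N c∈C →
      ∈-tabulate⁺ (λ c → atDistance? 2 c a)
        (atDistance2 a∈A c∈C (Graph.sym G (∈-tabulate⁻ (adj? b) c∈N)) (Graph.sym G ab))

    module _ {m} (N²≤m : ∀ {c} → c ∈ C → ∣ N² c ∩ A ∣ ℕ.≤ m) where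

      x∣A∣≤m : ∀ {r} → Below x r → (+ ∣ A ∣ / 1) ℚ.* r ℚ.≤ + m / 1
      x∣A∣≤m {r} r∈x = average adj? {A} {B} nonemptyA nonemptyB {r} {m}
        (λ {a} a∈A → ·-≤⁻ {∣ B ∣} {x} {+ ∣ N a ∩ B ∣ / 1} {r} (A→B a∈A) r∈x)
        (λ {b} b∈B → let (c , c∈C , bc) = AtLeast⇒neighbour {y} {B} 0<y nonemptyC B→C b∈B in
          -- A single neighbour `c` of `b` suffices: all neighbours of `b` in `A` are at distance
          -- two from it.
          ℕP.≤-trans (∣N∩A∣≤∣N²∩A∣ c∈C bc) (N²≤m c∈C))

      y∣A∣≤m : ∀ {r} → Below y r → (+ ∣ A ∣ / 1) ℚ.* r ℚ.≤ + m / 1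
      y∣A∣≤m {r} r∈y = average (λ a c → atDistance? 2 c a) {A} {C} nonemptyA nonemptyC {r} {m}
          (λ {a} a∈A → let (b , b∈B , ab) = AtLeast⇒neighbour {x} {A} 0<x nonemptyB A→B a∈A in
            ℚP.≤-trans (·-≤⁻ {∣ C ∣} {y} {+ ∣ N b ∩ C ∣ / 1} {r} (B→C b∈B) r∈y)
              (/1-mono-≤ {+ ∣ N b ∩ C ∣} {+ ∣ row (λ a c → atDistance? 2 c a) a ∩ C ∣} (ℤ.+≤+ (∣N∩C∣≤∣N²∩C∣ a∈A ab))))
          -- With the arguments reversed, the column of `c` is `N² c` by definition.
          N²≤m

    constrained⇒hasVertex : HasVertex (x ⊔ℝ y) G P
    constrained⇒hasVertex = let (v , v∈C , v-max) = maximiser (λ c → ∣ N² c ∩ A ∣) nonemptyC in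
      v , v∈C , ·-≤⁺ {∣ A ∣} {x ⊔ℝ y} {+ ∣ N² v ∩ A ∣ / 1} [ x∣A∣≤m v-max , y∣A∣≤m v-max ]

-- Residues modulo k

sum-const : ∀ n c → sum {n} (λ _ → c) ≡ n ℕ.* c
sum-const zero    c = refl
sum-const (suc n) c = cong (c ℕ.+_) (sum-const n c)

sum-splitAt : ∀ m {n} (f : Fin m ⊎ Fin n → ℕ) → sum (f ∘ splitAt m) ≡ sum (f ∘ inj₁) ℕ.+ sum (f ∘ inj₂)
sum-splitAt zero    f = refl
sum-splitAt (suc m) f = trans (cong (f (inj₁ zero) ℕ.+_) (sum-splitAt m (f ∘ map₁ suc)))
                              (sym (ℕP.+-assoc (f (inj₁ zero)) _ _))

#[i<p]≤p : ∀ k p → sum {k} (λ i → ⟦ does (toℕ i ℕ.<? p) ⟧) ℕ.≤ p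
#[i<p]≤p zero    p       = ℕ.z≤n
#[i<p]≤p (suc k) zero    = ℕP.≤-reflexive (sum-replicate-zero k)
#[i<p]≤p (suc k) (suc p) = ℕ.s≤s (#[i<p]≤p k p)

#[i<p]≡p : ∀ {k p} → p ℕ.≤ k → sum {k} (λ i → ⟦ does (toℕ i ℕ.<? p) ⟧) ≡ p
#[i<p]≡p {k} ℕ.z≤n   = sum-replicate-zero k
#[i<p]≡p (ℕ.s≤s p≤k) = cong suc (#[i<p]≡p p≤k)

module _ {k} .{{_ : NonZero k}} where

  %-cong-+ʳ : ∀ {a b} c → a % k ≡ b % k → (a ℕ.+ c) % k ≡ (b ℕ.+ c) % k
  %-cong-+ʳ {a} {b} c eq = begin
    (a ℕ.+ c) % k            ≡⟨ %-distribˡ-+ a c k ⟩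
    (a % k ℕ.+ c % k) % k    ≡⟨ cong (λ r → (r ℕ.+ c % k) % k) eq ⟩
    (b % k ℕ.+ c % k) % k    ≡⟨ %-distribˡ-+ b c k ⟨
    (b ℕ.+ c) % k            ∎
    where open ≡-Reasoning

  -- `c * (k - 1)` serves as the additive inverse of `c` modulo `k`, since
  -- `c + c * (k - 1) = c * k`; no subtraction of naturals is involved.
  +-negate : ∀ a c → (a ℕ.+ c ℕ.+ c ℕ.* ℕ.pred k) % k ≡ a % k
  +-negate a c = begin
    (a ℕ.+ c ℕ.+ c ℕ.* ℕ.pred k) % k     ≡⟨ cong (_% k) (ℕP.+-assoc a c _) ⟩
    (a ℕ.+ (c ℕ.+ c ℕ.* ℕ.pred k)) % k   ≡⟨ cong (λ m → (a ℕ.+ m) % k) (ℕP.*-suc c (ℕ.pred k)) ⟨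
    (a ℕ.+ c ℕ.* suc (ℕ.pred k)) % k     ≡⟨ cong (λ m → (a ℕ.+ c ℕ.* m) % k) (ℕP.suc-pred k) ⟩
    (a ℕ.+ c ℕ.* k) % k                  ≡⟨ %-remove-+ʳ a (n∣m*n c) ⟩
    a % k                                ∎
    where open ≡-Reasoning

  %-cancel-+ʳ : ∀ {a b} c → (a ℕ.+ c) % k ≡ (b ℕ.+ c) % k → a % k ≡ b % k
  %-cancel-+ʳ {a} {b} c eq =
    trans (sym (+-negate a c)) (trans (%-cong-+ʳ {a ℕ.+ c} {b ℕ.+ c} (c ℕ.* ℕ.pred k) eq) (+-negate b c))

  rotate : ℕ → Fin k → Fin k
  rotate s i = (toℕ i ℕ.+ s) mod k

  toℕ-rotate : ∀ s i → toℕ (rotate s i) ≡ (toℕ i ℕ.+ s) % k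
  toℕ-rotate s i = toℕ-fromℕ< _

  toℕ-rotate² : ∀ s t i → toℕ (rotate t (rotate s i)) ≡ (toℕ i ℕ.+ s ℕ.+ t) % k
  toℕ-rotate² s t i = begin
    toℕ (rotate t (rotate s i))     ≡⟨ toℕ-rotate t (rotate s i) ⟩
    (toℕ (rotate s i) ℕ.+ t) % k    ≡⟨ cong (λ m → (m ℕ.+ t) % k) (toℕ-rotate s i) ⟩
    ((toℕ i ℕ.+ s) % k ℕ.+ t) % k   ≡⟨ %-cong-+ʳ {(toℕ i ℕ.+ s) % k} {toℕ i ℕ.+ s} t (m%n%n≡m%n (toℕ i ℕ.+ s) k) ⟩
    (toℕ i ℕ.+ s ℕ.+ t) % k         ∎
    where open ≡-Reasoning

  -- The inverse of the shift by `s` is the shift by `s * (k - 1)`, the inverse residue of `s`.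
  rotation : ℕ → Permutation′ k
  rotation s = permutation (rotate s) (rotate s̄)
    (λ i → toℕ-injective (trans (toℕ-rotate² s̄ s i) (trans (cong (_% k) (swap (toℕ i))) (undo i))))
    (λ i → toℕ-injective (trans (toℕ-rotate² s s̄ i) (undo i)))
    where
    s̄ = s ℕ.* ℕ.pred k
    swap : ∀ n → n ℕ.+ s̄ ℕ.+ s ≡ n ℕ.+ s ℕ.+ s̄
    swap n = trans (ℕP.+-assoc n s̄ s) (trans (cong (n ℕ.+_) (ℕP.+-comm s̄ s)) (sym (ℕP.+-assoc n s s̄)))
    undo : ∀ i → (toℕ i ℕ.+ s ℕ.+ s̄) % k ≡ toℕ i
    undo i = trans (+-negate (toℕ i) s) (m<n⇒m%n≡m (toℕ<n i))

  #residues : ℕ → ℕ → ℕ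
  #residues s p = sum {k} λ i → ⟦ does ((toℕ i ℕ.+ s) % k ℕ.<? p) ⟧

  -- Shifting permutes the residues, so the sum may be reindexed by `rotation s`.
  #residues-shift : ∀ s p → #residues s p ≡ sum {k} λ i → ⟦ does (toℕ i ℕ.<? p) ⟧
  #residues-shift s p = sym (trans (sum-permute (λ i → ⟦ does (toℕ i ℕ.<? p) ⟧) (rotation s))
    (sum-cong-≗ λ i → cong (λ m → ⟦ does (m ℕ.<? p) ⟧) (toℕ-rotate s i)))

  -- Stated for every `p`, as it is applied to `p + q′`, which may exceed `k`.
  #residues≤ : ∀ s p → #residues s p ℕ.≤ p
  #residues≤ s p = subst (ℕ._≤ p) (sym (#residues-shift s p)) (#[i<p]≤p k p)

  #residues≡ : ∀ s {p} → p ℕ.≤ k → #residues s p ≡ p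
  #residues≡ s {p} p≤k = trans (#residues-shift s p) (#[i<p]≡p p≤k)

  -- i − l = (i + j) − (j + l) lies in the interval (−q, p), translated here by q − 1 = q′ (and by k, as ∸ truncates).
  difference-interval : ∀ {p q′} (i j l : ℕ) → l ℕ.≤ k →
    (i ℕ.+ j) % k ℕ.< p → (j ℕ.+ l) % k ℕ.< suc q′ →
    (i ℕ.+ (k ℕ.∸ l ℕ.+ q′)) % k ℕ.< p ℕ.+ q′
  difference-interval {p} {q′} i j l l≤k α<p (ℕ.s≤s β≤q′) = begin-strict
    (i ℕ.+ (k ℕ.∸ l ℕ.+ q′)) % k   ≡⟨ %-cancel-+ʳ (j ℕ.+ l) congruent ⟩
    (α ℕ.+ (q′ ℕ.∸ β)) % k         ≤⟨ m%n≤m (α ℕ.+ (q′ ℕ.∸ β)) k ⟩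
    α ℕ.+ (q′ ℕ.∸ β)               <⟨ ℕP.+-mono-<-≤ α<p (ℕP.m∸n≤m q′ β) ⟩
    p ℕ.+ q′                       ∎
    where
    open ℕP.≤-Reasoning
    open +-*-Solver using (solve; _:+_; _:=_)
    α = (i ℕ.+ j) % k
    β = (j ℕ.+ l) % k
    -- After adding `j + l`, both sides are congruent to `i + j + q′`: on the left `k - l + l`
    -- contributes only `k`, and on the right `j + l` cancels against `β`. The truncated differences
    -- are exact because `l ≤ k` and `β ≤ q′`.
    congruent : (i ℕ.+ (k ℕ.∸ l ℕ.+ q′) ℕ.+ (j ℕ.+ l)) % k ≡ (α ℕ.+ (q′ ℕ.∸ β) ℕ.+ (j ℕ.+ l)) % k
    congruent = begin-equality
      (i ℕ.+ (k ℕ.∸ l ℕ.+ q′) ℕ.+ (j ℕ.+ l)) % k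
        ≡⟨ cong (_% k) (solve 5 (λ i m q j l → i :+ (m :+ q) :+ (j :+ l) := i :+ j :+ q :+ (m :+ l)) refl i (k ℕ.∸ l) q′ j l) ⟩
      (i ℕ.+ j ℕ.+ q′ ℕ.+ (k ℕ.∸ l ℕ.+ l)) % k
        ≡⟨ cong (λ m → (i ℕ.+ j ℕ.+ q′ ℕ.+ m) % k) (ℕP.m∸n+n≡m l≤k) ⟩
      (i ℕ.+ j ℕ.+ q′ ℕ.+ k) % k
        ≡⟨ [m+n]%n≡m%n (i ℕ.+ j ℕ.+ q′) k ⟩
      (i ℕ.+ j ℕ.+ q′) % k
        ≡⟨ %-cong-+ʳ {i ℕ.+ j} {α} q′ (sym (m%n%n≡m%n (i ℕ.+ j) k)) ⟩
      (α ℕ.+ q′) % k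
        ≡⟨ cong (λ m → (α ℕ.+ m) % k) (ℕP.m∸n+n≡m β≤q′) ⟨
      (α ℕ.+ (q′ ℕ.∸ β ℕ.+ β)) % k
        ≡⟨ cong (_% k) (solve 3 (λ α m β → α :+ (m :+ β) := β :+ (α :+ m)) refl α (q′ ℕ.∸ β) β) ⟩
      (β ℕ.+ (α ℕ.+ (q′ ℕ.∸ β))) % k
        ≡⟨ %-cong-+ʳ {β} {j ℕ.+ l} (α ℕ.+ (q′ ℕ.∸ β)) (m%n%n≡m%n (j ℕ.+ l) k) ⟩
      (j ℕ.+ l ℕ.+ (α ℕ.+ (q′ ℕ.∸ β))) % k
        ≡⟨ cong (_% k) (ℕP.+-comm (j ℕ.+ l) (α ℕ.+ (q′ ℕ.∸ β))) ⟩
      (α ℕ.+ (q′ ℕ.∸ β) ℕ.+ (j ℕ.+ l)) % k ∎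

-- The circulant graph

Exactly⇒AtLeast : ∀ (G : Graph) {r s S T} → r ≤ℝ s → Graph.Exactly G s S T → Graph.AtLeast G r S T
Exactly⇒AtLeast G {r} {s} {T = T} r≤s exact v∈S q∈ = proj₂ (exact v∈S) (·-monoʳ-≤ ∣ T ∣ {r} {s} r≤s q∈)

-- The degree between `B` and `C` is `suc q′`, so that the bound `p + q - 1` becomes the natural
-- number `p + q′`.
module Circulant (k p q′ : ℕ) .{{_ : NonZero k}} (p≤k : p ℕ.≤ k) (q≤k : suc q′ ℕ.≤ k) where

  data Vertex : Set where
    a b c : Fin k → Vertex

  decode : Fin (k ℕ.+ (k ℕ.+ k)) → Vertex
  decode v = [ a , [ b , c ] ∘ splitAt k ] (splitAt k v)

  sum-decode : ∀ (f : Vertex → ℕ) →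
    sum (f ∘ decode) ≡ sum (f ∘ a) ℕ.+ (sum (f ∘ b) ℕ.+ sum (f ∘ c))
  sum-decode f = trans (sum-splitAt k (f ∘ [ a , [ b , c ] ∘ splitAt k ]))
    (cong (sum (f ∘ a) ℕ.+_) (sum-splitAt k (f ∘ [ b , c ])))

  -- Taking i + j rather than j − i makes the relation symmetric, so that one count gives both degrees.
  Near : ℕ → Fin k → Fin k → Set
  Near r i j = (toℕ j ℕ.+ toℕ i) % k ℕ.< r

  near? : ∀ r i j → Dec (Near r i j)
  near? r i j = (toℕ j ℕ.+ toℕ i) % k ℕ.<? r

  Near-sym : ∀ {r} i j → Near r i j → Near r j i
  Near-sym {r} i j = subst (λ m → m % k ℕ.< r) (ℕP.+-comm (toℕ j) (toℕ i))

  #near : ∀ {r} → r ℕ.≤ k → ∀ i → sum (λ j → ⟦ does (near? r i j) ⟧) ≡ r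
  #near r≤k i = #residues≡ (toℕ i) r≤k

  Edge : Vertex → Vertex → Set
  Edge (a i) (b j) = Near p i j
  Edge (b j) (a i) = Near p j i
  Edge (b j) (c l) = Near (suc q′) j l
  Edge (c l) (b j) = Near (suc q′) l j
  Edge (a _) (a _) = ⊥
  Edge (a _) (c _) = ⊥
  Edge (b _) (b _) = ⊥
  Edge (c _) (a _) = ⊥
  Edge (c _) (c _) = ⊥

  edge? : ∀ u v → Dec (Edge u v)
  edge? (a i) (b j) = near? p i j
  edge? (b j) (a i) = near? p j i
  edge? (b j) (c l) = near? (suc q′) j l
  edge? (c l) (b j) = near? (suc q′) l j
  edge? (a _) (a _) = no λ ()
  edge? (a _) (c _) = no λ ()
  edge? (b _) (b _) = no λ ()
  edge? (c _) (a _) = no λ ()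
  edge? (c _) (c _) = no λ ()

  Edge-sym : ∀ u v → Edge u v → Edge v u
  Edge-sym (a i) (b j) = Near-sym i j
  Edge-sym (b j) (a i) = Near-sym j i
  Edge-sym (b j) (c l) = Near-sym j l
  Edge-sym (c l) (b j) = Near-sym l j

  -- Reading the three classes as colours lets disjointness and stability be proved once for all of
  -- them.
  part : Vertex → Fin 3
  part (a _) = 0F
  part (b _) = 1F
  part (c _) = 2F

  Edge⇒part≢ : ∀ u v → Edge u v → part u ≢ part v
  Edge⇒part≢ (a _) (b _) _ ()
  Edge⇒part≢ (b _) (a _) _ ()
  Edge⇒part≢ (b _) (c _) _ ()
  Edge⇒part≢ (c _) (b _) _ ()

  ¬Edge-ac : ∀ u v → part u ≡ 0F → part v ≡ 2F → ¬ Edge u v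
  ¬Edge-ac (a _) (c _) _ _ ()

  graph : Graph
  graph = record
    { order  = k ℕ.+ (k ℕ.+ k)
    ; Adj    = λ u v → Edge (decode u) (decode v)
    ; adj?   = λ u v → edge? (decode u) (decode v)
    ; sym    = λ {u} {v} → Edge-sym (decode u) (decode v)
    ; irrefl = λ { {u} refl e → Edge⇒part≢ (decode u) (decode u) e refl }
    }

  open Graph graph using (N; N²; atDistance?; AtDistance)

  part? : ∀ t v → Dec (part (decode v) ≡ t)
  part? t v = part (decode v) ≟ᶠ t

  Part : Fin 3 → Subset (k ℕ.+ (k ℕ.+ k))
  Part t = tabulate (does ∘ part? t)

  ∈Part⁻ : ∀ {t v} → v ∈ Part t → part (decode v) ≡ t
  ∈Part⁻ {t} = ∈-tabulate⁻ (part? t)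

  ∣tabulate∣≡∑ : ∀ (f : Vertex → Bool) → ∣ tabulate (f ∘ decode) ∣ ≡
    sum (λ i → ⟦ f (a i) ⟧) ℕ.+ (sum (λ j → ⟦ f (b j) ⟧) ℕ.+ sum (λ l → ⟦ f (c l) ⟧))
  ∣tabulate∣≡∑ f = trans (∣p∣≡∑ (tabulate (f ∘ decode)))
    (trans (sum-cong-≗ λ v → cong ⟦_⟧ (lookup∘tabulate (f ∘ decode) v)) (sum-decode (⟦_⟧ ∘ f)))

  sum-0 : sum {k} (λ _ → 0) ≡ 0
  sum-0 = sum-replicate-zero k

  sum-1 : sum {k} (λ _ → 1) ≡ k
  sum-1 = trans (sum-const k 1) (ℕP.*-identityʳ k)

  -- The names of this and the next two lemmas show which of the sums over `A`, `B`, `C` survives.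
  +00 : ∀ {m n o d} → m ≡ d → n ≡ 0 → o ≡ 0 → m ℕ.+ (n ℕ.+ o) ≡ d
  +00 {d = d} refl refl refl = ℕP.+-identityʳ d

  0+0 : ∀ {m n o d} → m ≡ 0 → n ≡ d → o ≡ 0 → m ℕ.+ (n ℕ.+ o) ≡ d
  0+0 {d = d} refl refl refl = ℕP.+-identityʳ d

  00+ : ∀ {m n o d} → m ≡ 0 → n ≡ 0 → o ≡ d → m ℕ.+ (n ℕ.+ o) ≡ d
  00+ refl refl refl = refl

  ∣Part∣≡k : ∀ t → ∣ Part t ∣ ≡ k
  ∣Part∣≡k t = trans (∣tabulate∣≡∑ λ v → does (part v ≟ᶠ t)) (count t)
    where
    count : ∀ t → sum (λ i → ⟦ does (part (a i) ≟ᶠ t) ⟧) ℕ.+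
      (sum (λ j → ⟦ does (part (b j) ≟ᶠ t) ⟧) ℕ.+ sum (λ l → ⟦ does (part (c l) ≟ᶠ t) ⟧)) ≡ k
    count 0F = +00 sum-1 sum-0 sum-0
    count 1F = 0+0 sum-0 sum-1 sum-0
    count 2F = 00+ sum-0 sum-0 sum-1

  -- Splitting the sum by class makes all indicators compute once the class of `u` is known, except
  -- the `Near` tests, which `sum-near*0` and `sum-near*1` handle.
  degree : Vertex → Fin 3 → ℕ
  degree u t = sum (λ i → deg (a i)) ℕ.+ (sum (λ j → deg (b j)) ℕ.+ sum (λ l → deg (c l)))
    where
    deg : Vertex → ℕ
    deg v = ⟦ does (edge? u v) ⟧ ℕ.* ⟦ does (part v ≟ᶠ t) ⟧

  ∣N∩Part∣≡degree : ∀ v t → ∣ N v ∩ Part t ∣ ≡ degree (decode v) t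
  ∣N∩Part∣≡degree v t = trans (∣p∩q∣≡∑ (N v) (Part t))
    (trans (sum-cong-≗ λ u → cong₂ (λ x y → ⟦ x ⟧ ℕ.* ⟦ y ⟧) (lookup∘tabulate _ u) (lookup∘tabulate (does ∘ part? t) u))
           (sum-decode λ u → ⟦ does (edge? (decode v) u) ⟧ ℕ.* ⟦ does (part u ≟ᶠ t) ⟧))

  sum-near*0 : ∀ r i → sum (λ j → ⟦ does (near? r i j) ⟧ ℕ.* 0) ≡ 0
  sum-near*0 r i = trans (sum-cong-≗ λ j → ℕP.*-zeroʳ ⟦ does (near? r i j) ⟧) sum-0

  sum-near*1 : ∀ {r} → r ℕ.≤ k → ∀ i → sum (λ j → ⟦ does (near? r i j) ⟧ ℕ.* 1) ≡ r
  sum-near*1 {r} r≤k i = trans (sum-cong-≗ λ j → ℕP.*-identityʳ ⟦ does (near? r i j) ⟧) (#near r≤k i)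

  degree-ab : ∀ u → part u ≡ 0F → degree u 1F ≡ p
  degree-ab (a i) _ = 0+0 sum-0 (sum-near*1 p≤k i) sum-0

  degree-ba : ∀ u → part u ≡ 1F → degree u 0F ≡ p
  degree-ba (b j) _ = +00 (sum-near*1 p≤k j) sum-0 (sum-near*0 (suc q′) j)

  degree-bc : ∀ u → part u ≡ 1F → degree u 2F ≡ suc q′
  degree-bc (b j) _ = 00+ (sum-near*0 p j) sum-0 (sum-near*1 q≤k j)

  degree-cb : ∀ u → part u ≡ 2F → degree u 1F ≡ suc q′
  degree-cb (c l) _ = 0+0 sum-0 (sum-near*1 q≤k l) sum-0

  tripartition : Tripartition graph
  tripartition = record
    { A = Part 0F ; B = Part 1F ; C = Part 2F
    ; cover      = λ v → cover v (decode v) refl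
    ; disjointAB = disjoint λ ()
    ; disjointAC = disjoint λ ()
    ; disjointBC = disjoint λ ()
    ; nonemptyA  = nonemptyPart 0F
    ; nonemptyB  = nonemptyPart 1F
    ; nonemptyC  = nonemptyPart 2F
    ; stableA    = stable
    ; stableB    = stable
    ; stableC    = stable
    }
    where
    cover : ∀ v x → decode v ≡ x → v ∈ Part 0F ⊎ v ∈ Part 1F ⊎ v ∈ Part 2F
    cover v (a _) eq = inj₁ (∈-tabulate⁺ (part? 0F) (cong part eq))
    cover v (b _) eq = inj₂ (inj₁ (∈-tabulate⁺ (part? 1F) (cong part eq)))
    cover v (c _) eq = inj₂ (inj₂ (∈-tabulate⁺ (part? 2F) (cong part eq)))
    disjoint : ∀ {s t} → s ≢ t → Graph.Disjoint graph (Part s) (Part t)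
    disjoint s≢t v∈s v∈t = s≢t (trans (sym (∈Part⁻ v∈s)) (∈Part⁻ v∈t))
    nonemptyPart : ∀ t → Nonempty (Part t)
    nonemptyPart t = 0<∣p∣⇒nonempty (Part t) (subst (0 ℕ.<_) (sym (∣Part∣≡k t)) (ℕ.>-nonZero⁻¹ k))
    stable : ∀ {t} → Graph.Stable graph (Part t)
    stable {u = u} {v} u∈t v∈t e = Edge⇒part≢ (decode u) (decode v) e (trans (∈Part⁻ u∈t) (sym (∈Part⁻ v∈t)))

  exact : ∀ {x y} → x ≤ℝ fromℚ (+ p / k) → y ≤ℝ fromℚ (+ suc q′ / k) → Exact x y graph tripartition
  exact {x} {y} x≤p/k y≤q/k = record
    { constrained = record
      { A→B = Exactly⇒AtLeast graph {x} {fromℚ (+ p / k)} {Part 0F} {Part 1F} x≤p/k A→B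
      ; B→C = Exactly⇒AtLeast graph {y} {fromℚ (+ suc q′ / k)} {Part 1F} {Part 2F} y≤q/k B→C
      ; A-C = λ {u} {v} u∈A v∈C → ¬Edge-ac (decode u) (decode v) (∈Part⁻ u∈A) (∈Part⁻ v∈C)
      }
    ; x′ = fromℚ (+ p / k)
    ; y′ = fromℚ (+ suc q′ / k)
    ; x≤x′ = x≤p/k
    ; y≤y′ = y≤q/k
    ; A→B = A→B
    ; B→A = regular degree-ba
    ; B→C = B→C
    ; C→B = regular degree-cb
    }
    where
    regular : ∀ {s t d} → (∀ u → part u ≡ s → degree u t ≡ d) →
              Graph.Exactly graph (fromℚ (+ d / k)) (Part s) (Part t)
    regular {s} {t} {d} deg≡d {v} v∈s = subst₂ (λ m n → fromℕ m ≈ℝ n · fromℚ (+ d / k))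
      (sym (trans (∣N∩Part∣≡degree v t) (deg≡d (decode v) (∈Part⁻ v∈s)))) (sym (∣Part∣≡k t)) (n·[i/n]≈i k (+ d))
    A→B : Graph.Exactly graph (fromℚ (+ p / k)) (Part 0F) (Part 1F)
    A→B = regular degree-ab
    B→C : Graph.Exactly graph (fromℚ (+ suc q′ / k)) (Part 1F) (Part 2F)
    B→C = regular degree-bc

  -- A superset of the vertices of `A` at distance two from `c l`: a shifted interval of `p + q′`
  -- residues, by `difference-interval`.
  Target : Fin k → Vertex → Set
  Target l (a i) = (toℕ i ℕ.+ (k ℕ.∸ toℕ l ℕ.+ q′)) % k ℕ.< p ℕ.+ q′
  Target l (b _) = ⊥
  Target l (c _) = ⊥

  target? : ∀ l v → Dec (Target l v)
  target? l (a i) = (toℕ i ℕ.+ (k ℕ.∸ toℕ l ℕ.+ q′)) % k ℕ.<? p ℕ.+ q′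
  target? l (b _) = no λ ()
  target? l (c _) = no λ ()

  twoSteps⇒Target : ∀ l w u → part u ≡ 0F → Edge (c l) w → Edge w u → Target l u
  twoSteps⇒Target l (b j) (a i) _ lj ji =
    difference-interval (toℕ i) (toℕ j) (toℕ l) (ℕP.<⇒≤ (toℕ<n l)) ji lj

  ∣Target∣≤ : ∀ l → ∣ tabulate (does ∘ target? l ∘ decode) ∣ ℕ.≤ p ℕ.+ q′
  ∣Target∣≤ l = ℕP.≤-trans
    (ℕP.≤-reflexive (trans (∣tabulate∣≡∑ (does ∘ target? l)) (+00 refl sum-0 sum-0)))
    (#residues≤ (k ℕ.∸ toℕ l ℕ.+ q′) (p ℕ.+ q′))

  ∣N²∩A∣≤ : ∀ {v} → v ∈ Part 2F → ∣ N² v ∩ Part 0F ∣ ℕ.≤ p ℕ.+ q′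
  ∣N²∩A∣≤ {v} v∈C = bound (decode v) refl (∈Part⁻ v∈C)
    where
    -- Abstracting `decode v` permits matching on its class while the equation keeps the link to
    -- `v`.
    bound : ∀ x → decode v ≡ x → part x ≡ 2F → ∣ N² v ∩ Part 0F ∣ ℕ.≤ p ℕ.+ q′
    bound (c l) v≡l _ = ℕP.≤-trans (p⊆q⇒∣p∣≤∣q∣ λ u∈ → N²∩A⊆Target (x∈p∩q⁻ (N² v) (Part 0F) u∈)) (∣Target∣≤ l)
      where
      target : ∀ {u} → AtDistance 2 v u → part (decode u) ≡ 0F → Target l (decode u)
      target {u} ((w , vw , _ , wu , refl) , _) u∈A =
        twoSteps⇒Target l (decode w) (decode u) u∈A (subst (λ x → Edge x (decode w)) v≡l vw) wu
      N²∩A⊆Target : ∀ {u} → u ∈ N² v × u ∈ Part 0F → u ∈ tabulate (does ∘ target? l ∘ decode)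
      N²∩A⊆Target {u} (u∈N² , u∈A) = ∈-tabulate⁺ (target? l ∘ decode) (target (∈-tabulate⁻ (atDistance? 2 v) u∈N²) (∈Part⁻ u∈A))

  hasVertex⇒≤ : ∀ {z} → HasVertex z graph tripartition → z ≤ℝ fromℚ (+ (p ℕ.+ q′) / k)
  hasVertex⇒≤ {z} (v , v∈C , kz≤) = n·x≤i⇒x≤i/n k {z} (+ (p ℕ.+ q′)) λ q∈ →
    ℚP.<-≤-trans (subst (λ n → n · z ≤ℝ fromℕ ∣ N² v ∩ Part 0F ∣) (∣Part∣≡k 0F) kz≤ q∈)
      (/1-mono-≤ {+ ∣ N² v ∩ Part 0F ∣} {+ (p ℕ.+ q′)} (ℤ.+≤+ (∣N²∩A∣≤ v∈C)))

-- The chain of inequalities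

exact⇒biconstrained : ∀ {x y G P} → Exact x y G P → Biconstrained x y G P
exact⇒biconstrained {x} {y} {G} {P} ex = record
  { constrained = Exact.constrained ex
  ; B→A = Exactly⇒AtLeast G {x} {x′} {B} {A} x≤x′ (Exact.B→A ex)
  ; C→B = Exactly⇒AtLeast G {y} {y′} {C} {B} y≤y′ (Exact.C→B ex)
  }
  where
  open Tripartition P
  open Exact ex using (x′; y′; x≤x′; y≤y′)

p+q-1≡p+q′ : ∀ p q′ → + p + + suc q′ - 1ℤ ≡ + (p ℕ.+ q′)
p+q-1≡p+q′ p q′ = cong (λ n → + n - 1ℤ) (ℕP.+-suc p q′)

module _ {x y ξ : ℝ} (ξ-exact : ∀ G P → Exact x y G P → HasVertex ξ G P) (k : ℕ) .{{_ : NonZero k}} where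

  ξ-upper-bound : ∀ p q → + 0 ℤ.< p → + 0 ℤ.< q → p ℤ.≤ + k → q ℤ.≤ + k →
    x ≤ℝ fromℚ (p / k) → y ≤ℝ fromℚ (q / k) → ξ ≤ℝ fromℚ ((p + q - 1ℤ) / k)
  -- Positivity of `q` rules out zero, leaving the form `suc q′` on which the circulant graph is
  -- built.
  ξ-upper-bound (+ p) (+ zero) _ (ℤ.+<+ ()) _ _ _ _
  ξ-upper-bound (+ p) (+ suc q′) _ _ (ℤ.+≤+ p≤k) (ℤ.+≤+ q≤k) x≤p/k y≤q/k =
    subst (λ i → ξ ≤ℝ fromℚ (i / k)) (sym (p+q-1≡p+q′ p q′))
      (hasVertex⇒≤ {ξ} (ξ-exact graph tripartition (exact {x} {y} x≤p/k y≤q/k)))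
    where open Circulant k p q′ p≤k q≤k

mainTheorem5 : (x y : ℝ) → InUnitInterval x → InUnitInterval y →
    (φ ψ ξ : ℝ) → Isφ x y φ → Isψ x y ψ → Isξ x y ξ →
    (k : ℕ) → .{{_ : NonZero k}} →
    (x ⊔ℝ y ≤ℝ φ) × (φ ≤ℝ ψ) × (ψ ≤ℝ ξ) ×
    ((⌈kx⌉ ⌈ky⌉ : ℤ) → IsCeiling (k · x) ⌈kx⌉ → IsCeiling (k · y) ⌈ky⌉ →
    ξ ≤ℝ fromℚ ((⌈kx⌉ + ⌈ky⌉ - 1ℤ) / k))
mainTheorem5 x y (0<x , x≤1) (0<y , y≤1) φ ψ ξ (φ∈I , φ-con , φ-max) (ψ∈I , ψ-bi , ψ-max) (_ , ξ-exact , ξ-max) k =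
    -- Each of the first three inequalities comes from maximality: the smaller value lies in the
    -- unit interval and has the property that defines the larger one.
    φ-max (x ⊔ℝ y) x⊔y∈I (λ G P → constrained⇒hasVertex G P {x} {y} 0<x 0<y)
  , ψ-max φ φ∈I (λ G P bi → φ-con G P (Biconstrained.constrained bi))
  , ξ-max ψ ψ∈I (λ G P ex → ψ-bi G P (exact⇒biconstrained ex))
  , λ p q (kx≤p , p-min) (ky≤q , q-min) →
      ξ-upper-bound {x} {y} {ξ} ξ-exact k p q
        (n·x≤m⇒0<m k {x} 0<x kx≤p) (n·x≤m⇒0<m k {y} 0<y ky≤q)
        -- Since `x` and `y` are at most 1, `k` is an integer upper bound for `k · x` and `k · y`;
        -- minimality of the ceilings keeps both degrees within a class of size `k`.
        (p-min (+ k) (n·x≤n k {x} x≤1)) (q-min (+ k) (n·x≤n k {y} y≤1))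
        (n·x≤i⇒x≤i/n k {x} p kx≤p) (n·x≤i⇒x≤i/n k {y} q ky≤q)
  where
  x⊔y∈I : InUnitInterval (x ⊔ℝ y)
  x⊔y∈I = let (r , r∈x , r≮0) = 0<x in (r , inj₁ r∈x , r≮0) , [ x≤1 , y≤1 ]
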